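{- Fix $\beta\in(0,1]$ and $k\ge 2$. For every (possibly randomized) algorithm for the improving multi-armed bandits problem with $k$ arms, for $T$ sufficiently large, there exists an instance with Concavity Envelope Exponent $\beta_I=\beta$ such that $$\frac{\mathbb{E}[ALG_T]}{OPT_T}\ \le\ C_\beta\,k^{ -\beta/(\beta+1)},\qquad C_\beta=\tfrac32(\beta+1)^2\,[\beta(\beta+1)]^{ -\beta/(\beta+1)}.$$ Equivalently, any such algorithm has an $\Omega(k^{\beta/(\beta+1)})$ competitive ratio.
   Context: An instance of the improving multi-armed bandits problem consists of $k$ arms; arm $i$ has a reward function $f_i:\{0,1,2,\dots\}\to\mathbb{R}_{\ge 0}$ that is nondecreasing, satisfies $f_i(0)=0$, and has diminishing returns: $f_i(t+1)-f_i(t)\le f_i(t)-f_i(t-1)$ for all $t\ge 1$. Pulling arm $i$ for the $t$-th time yields reward $f_i(t)$. An algorithm pulls one arm per step for $T$ steps, observing only the rewards of its own pulls; $ALG_T$ is the sum of the rewards obtained and the expectation is over its internal randomness. $OPT_T=\max_i\sum_{t=1}^T f_i(t)$ (taken to be positive). The competitive ratio is $OPT_T/\mathbb{E}[ALG_T]$. For $\beta\in(0,1]$, arm $i$ satisfies $\mathrm{LE}(\beta)$ if $f_i(t)\ge f_i(T)(t/T)^\beta$ for all $t\le T$. The Concavity Envelope Exponent of an instance $I$ is $\beta_I=\inf\{\beta\in(0,1]:\text{every arm of }I\text{ satisfies }\mathrm{LE}(\beta)\}$. -}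

module Defs where

open import Algebra.Bundles using (CommutativeRing)
open import Algebra.Structures using (IsCommutativeRing)
import Algebra.Properties.Semiring.Mult as Mult
import Algebra.Properties.Semiring.Sum as Sum
open import Data.Fin.Base using (Fin; toℕ)
import Data.Fin.Properties as Fin
open import Data.List.Base using (List; []; _∷_; filter; length; tabulate)
import Data.List.Extrema as Extrema
open import Data.Nat.Base as ℕ using (ℕ; zero; suc)
open import Data.Product.Base using (∃; ∃-syntax; _×_; _,_; proj₁)
open import Level using (0ℓ)
open import Relation.Binary.Bundles using (DecTotalOrder)
open import Relation.Binary.Core using (Rel)
open import Relation.Binary.Structures using (IsDecTotalOrder)
import Relation.Binary.Construct.NonStrictToStrict as NonStrictToStrict
open import Relation.Binary.PropositionalEquality.Core using (_≡_; _≢_)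
open import Relation.Nullary.Decidable.Core using (yes; no)

module Bounds {A : Set} (_≤_ : Rel A 0ℓ) where

  IsUpperBound IsLowerBound IsSupremum IsInfimum : (A → Set) → A → Set
  IsUpperBound P b = ∀ x → P x → x ≤ b
  IsLowerBound P b = ∀ x → P x → b ≤ x
  IsSupremum P s = IsUpperBound P s × (∀ b → IsUpperBound P b → s ≤ b)
  IsInfimum P i = IsLowerBound P i × (∀ b → IsLowerBound P b → b ≤ i)

-- The real numbers, given by the classical axioms of a complete ordered field.
-- These axioms determine the field up to isomorphism, and the functions
-- exp and (on positive arguments) log are determined by their laws, so a
-- statement about every such record is a statement about ℝ.  The Archimedean
-- property follows classically from completeness; it is listed because the
-- existence of the natural number is not derivable from it constructively.
record RealNumbers : Set₁ where
  infix  8 -_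
  infixl 7 _*_
  infixl 6 _+_
  infix  4 _≤_
  field
    ℝ       : Set
    _+_ _*_ : ℝ → ℝ → ℝ
    -_      : ℝ → ℝ
    0# 1#   : ℝ
    _≤_     : Rel ℝ 0ℓ

    isCommutativeRing : IsCommutativeRing _≡_ _+_ _*_ -_ 0# 1#
    isDecTotalOrder   : IsDecTotalOrder _≡_ _≤_

  commutativeRing : CommutativeRing 0ℓ 0ℓ
  commutativeRing = record { isCommutativeRing = isCommutativeRing }

  decTotalOrder : DecTotalOrder 0ℓ 0ℓ 0ℓ
  decTotalOrder = record { isDecTotalOrder = isDecTotalOrder }

  open IsDecTotalOrder isDecTotalOrder public using (_≤?_)
  open NonStrictToStrict _≡_ _≤_ public using (_<_)
  open Bounds _≤_ public
  open Mult (CommutativeRing.semiring commutativeRing) public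
    using () renaming (_×_ to _·_)

  fromℕ : ℕ → ℝ
  fromℕ n = n · 1#

  infix 9 _⁻¹
  field
    0≢1      : 0# ≢ 1#
    -- The value of 0# ⁻¹ is left unspecified.
    _⁻¹      : ℝ → ℝ
    *-inverseʳ : ∀ x → x ≢ 0# → x * x ⁻¹ ≡ 1#

    +-monoʳ-≤ : ∀ x {y z} → y ≤ z → x + y ≤ x + z
    *-nonneg  : ∀ {x y} → 0# ≤ x → 0# ≤ y → 0# ≤ x * y

    complete    : (P : ℝ → Set) → ∃ P → ∃ (IsUpperBound P) → ∃ (IsSupremum P)
    archimedean : ∀ x → ∃[ n ] x ≤ fromℕ n

    -- The functional equation and the tangent-line bound characterise the
    -- exponential function with base e.
    exp       : ℝ → ℝ
    exp-+     : ∀ x y → exp (x + y) ≡ exp x * exp y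
    1+x≤exp-x : ∀ x → 1# + x ≤ exp x

    -- Only the values at positive arguments are specified.
    log     : ℝ → ℝ
    exp-log : ∀ {x} → 0# < x → exp (log x) ≡ x

  infixl 6 _-_
  _-_ : ℝ → ℝ → ℝ
  x - y = x + (- y)

  infixl 7 _/_
  _/_ : ℝ → ℝ → ℝ
  x / y = x * y ⁻¹

  -- The first clause supplies 0 ^ a = 0 for a > 0; negative bases do not occur.
  infixr 8 _^_
  _^_ : ℝ → ℝ → ℝ
  x ^ a with x ≤? 0#
  ... | yes _ = 0#
  ... | no  _ = exp (a * log x)

module Bandits (R : RealNumbers) where

  open RealNumbers R
  open Sum (CommutativeRing.semiring commutativeRing) using (sum)
  open Extrema (DecTotalOrder.totalOrder decTotalOrder) using (max)

  record Instance (k : ℕ) : Set where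
    field
      f           : Fin k → ℕ → ℝ
      f-nonneg    : ∀ i t → 0# ≤ f i t
      f-mono      : ∀ i t → f i t ≤ f i (suc t)
      f-zero      : ∀ i → f i 0 ≡ 0#
      diminishing : ∀ i t →
        f i (suc (suc t)) - f i (suc t) ≤ f i (suc t) - f i t

  -- The arms pulled so far with the rewards observed, most recent pull first.
  History : ℕ → Set
  History k = List (Fin k × ℝ)

  pulls : ∀ {k} → Fin k → History k → ℕ
  pulls i h = length (filter (λ p → i Fin.≟ proj₁ p) h)

  -- A randomized algorithm draws the next arm from a probability distribution
  -- that may depend on everything it has observed; it may know the horizon T.
  record Algorithm (k : ℕ) : Set where
    field
      prob        : (T : ℕ) → History k → Fin k → ℝ
      prob-nonneg : ∀ T h i → 0# ≤ prob T h i
      prob-sum    : ∀ T h → sum (prob T h) ≡ 1#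

  module _ {k : ℕ} (I : Instance k) where

    open Instance I

    module _ (A : Algorithm k) (T : ℕ) where

      open Algorithm A

      -- Expected total reward of the next n pulls, given the history h.
      expectedReward : (n : ℕ) → History k → ℝ
      expectedReward zero    h = 0#
      expectedReward (suc n) h = sum λ i →
        let r = f i (suc (pulls i h)) in
        prob T h i * (r + expectedReward n ((i , r) ∷ h))

      E[ALG] : ℝ
      E[ALG] = expectedReward T []

    cumulative : Fin k → ℕ → ℝ
    cumulative i T = sum {T} λ t → f i (suc (toℕ t))

    -- All cumulative rewards are nonnegative, so the default 0# does not
    -- affect the maximum when k ≥ 1.
    OPT : ℕ → ℝ
    OPT T = max 0# (tabulate λ i → cumulative i T)

    LE : (T : ℕ) → ℝ → Fin k → Set
    LE T β i = ∀ t → t ℕ.≤ T → f i T * (fromℕ t / fromℕ T) ^ β ≤ f i t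

    IsConcavityEnvelopeExponent : (T : ℕ) → ℝ → Set
    IsConcavityEnvelopeExponent T =
      IsInfimum λ β → 0# < β × β ≤ 1# × (∀ i → LE T β i)

  C : ℝ → ℝ
  C β = (fromℕ 3 / fromℕ 2) * ((β + 1#) * (β + 1#))
        * (β * (β + 1#)) ^ (- (β / (β + 1#)))

{-# OPTIONS --safe #-}
module Submission where

open import Defs
open import Algebra.Bundles using (CommutativeRing)
import Algebra.Properties.AbelianGroup as AbelianGroupProperties
import Algebra.Properties.CommutativeMonoid.Sum as CommutativeMonoidSum
import Algebra.Properties.Ring as RingProperties
import Algebra.Properties.Semiring.Mult.TCOptimised as OptimisedMult
import Algebra.Properties.Semiring.Sum as SemiringSum
import Algebra.Solver.Ring as RingSolver
open import Algebra.Solver.Ring.AlmostCommutativeRing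
  using (fromCommutativeRing; _-Raw-AlmostCommutative⟶_)
open import Data.Fin.Base as Fin using (Fin; zero; suc; toℕ)
import Data.Fin.Properties as Fin
open import Data.Integer.Base as ℤ using (ℤ)
import Data.Integer.Properties as ℤ
open import Data.List.Base using ([]; _∷_; length; tabulate)
import Data.List.Extrema as Extrema
import Data.List.Properties as List
open import Data.List.Relation.Unary.All.Properties using (tabulate⁻)
open import Data.Maybe.Base using (Maybe; just; nothing)
open import Data.Nat.Base as ℕ using (ℕ; zero; suc; z≤n; s≤s)
import Data.Nat.Properties as ℕ
open import Data.Product.Base using (∃-syntax; _×_; _,_; proj₁; proj₂)
open import Data.Sum.Base using (inj₁; inj₂)
open import Level using (0ℓ)
open import Relation.Binary.Bundles using (DecTotalOrder)
open import Relation.Binary.PropositionalEquality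
  using (_≡_; _≢_; refl; sym; trans; cong; cong₂; subst; subst₂)
import Relation.Binary.Reasoning.PartialOrder as PartialOrderReasoning
open import Relation.Nullary using (¬_; Dec; yes; no; contradiction)

-- Against k arms that all pay g(t) = min(t, τ) ^ β, some arm j has expected number
-- of pulls at most T / k.  Let arm j pay p(t) = t ^ β instead.  The algorithm cannot
-- tell the difference before it pulls j more than τ times; until then it earns at
-- most p(τ) per step, and by Markov's inequality detection has probability at
-- most T / ((τ + 1) k).  Since the best arm accumulates at least
-- T ^ (β + 1) / (β + 1), the bound follows by taking τ = ⌊x T⌋ for the optimal x.

-- The cap does two jobs: it hides arm `j` among the others for its first `τ` pulls, and it keeps
-- every payment of another arm below `p τ`. A play is a tree of histories weighted by the
-- algorithm, and no probability of detection is ever formed on it. Markov's inequality is instead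
-- built into an induction over the tree: each pull of arm `j` in the reference play, where every
-- arm is capped, is priced at `S T / (τ + 1)`, so the `τ + 1` pulls that precede detection pay for
-- everything arm `j` can yield afterwards. The reference play singles out no arm, so `j` can be
-- read off from it before the hard instance exists. A larger `τ` raises the payment before
-- detection and makes detection rarer. In units of `S T` the two costs are at most `(β + 1) x ^ β`
-- and `1 / (x k)`. Their sum is least at `x = (β (β + 1) k) ^ (-1 / (β + 1))`, with value
-- `(β + 1)² (β (β + 1) k) ^ (-β / (β + 1))`; this is the source of the power of `k` and of the
-- shape of the constant. The uncapped arm is also what makes the envelope exponent exactly `β`.

-- The coefficients are integers because equality of real constants does not compute.
module IntegerCoefficients (A : CommutativeRing 0ℓ 0ℓ) where

  open import Data.Integer.Base using (+_; -[1+_]; _⊖_)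
  open CommutativeRing A hiding (trans; sym; refl; zero)
  open CommutativeRing A using () renaming (trans to ≈-trans; sym to ≈-sym; refl to ≈-refl)
  open RingProperties ring using (-‿distribˡ-*; -‿distribʳ-*; -‿involutive; -0#≈0#)
  open AbelianGroupProperties +-abelianGroup using (⁻¹-∙-comm)
  open OptimisedMult semiring using (×-homo-+; ×1-homo-*; 1+×) renaming (_×_ to _·′_)
  import Relation.Binary.Reasoning.Setoid setoid as ≈-Reasoning

  fromℤ : ℤ → Carrier
  fromℤ (+ n)    = n ·′ 1#
  fromℤ -[1+ n ] = - (suc n ·′ 1#)

  fromℤ-⊖ : ∀ m n → fromℤ (m ⊖ n) ≈ m ·′ 1# - n ·′ 1#
  fromℤ-⊖ zero    zero    = ≈-sym (-‿inverseʳ 0#)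
  fromℤ-⊖ zero    (suc n) = ≈-sym (+-identityˡ _)
  fromℤ-⊖ (suc m) zero    = ≈-sym (≈-trans (+-congˡ -0#≈0#) (+-identityʳ _))
  fromℤ-⊖ (suc m) (suc n) = begin
    fromℤ (suc m ⊖ suc n)                    ≡⟨ cong fromℤ (ℤ.[1+m]⊖[1+n]≡m⊖n m n) ⟩
    fromℤ (m ⊖ n)                            ≈⟨ fromℤ-⊖ m n ⟩
    m ·′ 1# - n ·′ 1#                        ≈⟨ +-congʳ (+-identityʳ _) ⟨
    m ·′ 1# + 0# - n ·′ 1#                   ≈⟨ +-congʳ (+-congˡ (-‿inverseʳ 1#)) ⟨
    m ·′ 1# + (1# - 1#) - n ·′ 1#            ≈⟨ +-congʳ (+-assoc _ _ _) ⟨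
    m ·′ 1# + 1# - 1# - n ·′ 1#              ≈⟨ +-congʳ (+-congʳ (+-comm _ _)) ⟩
    1# + m ·′ 1# - 1# - n ·′ 1#              ≈⟨ +-assoc _ _ _ ⟩
    1# + m ·′ 1# + (- 1# - n ·′ 1#)          ≈⟨ +-congˡ (⁻¹-∙-comm _ _) ⟩
    1# + m ·′ 1# - (1# + n ·′ 1#)            ≈⟨ +-cong (1+× m 1#) (-‿cong (1+× n 1#)) ⟨
    suc m ·′ 1# - suc n ·′ 1#                ∎
    where open ≈-Reasoning

  fromℤ-+ : ∀ i j → fromℤ (i ℤ.+ j) ≈ fromℤ i + fromℤ j
  fromℤ-+ (+ m)    (+ n)    = ×-homo-+ 1# m n
  fromℤ-+ (+ m)    -[1+ n ] = fromℤ-⊖ m (suc n)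
  fromℤ-+ -[1+ m ] (+ n)    = ≈-trans (fromℤ-⊖ n (suc m)) (+-comm _ _)
  fromℤ-+ -[1+ m ] -[1+ n ] = begin
    - (suc (suc (m ℕ.+ n)) ·′ 1#)       ≡⟨ cong (λ k → - (suc k ·′ 1#)) (ℕ.+-suc m n) ⟨
    - ((suc m ℕ.+ suc n) ·′ 1#)         ≈⟨ -‿cong (×-homo-+ 1# (suc m) (suc n)) ⟩
    - (suc m ·′ 1# + suc n ·′ 1#)       ≈⟨ ⁻¹-∙-comm _ _ ⟨
    - (suc m ·′ 1#) - suc n ·′ 1#       ∎
    where open ≈-Reasoning

  fromℤ-neg : ∀ i → fromℤ (ℤ.- i) ≈ - fromℤ i
  fromℤ-neg (+ zero)  = ≈-sym -0#≈0#
  fromℤ-neg (+ suc n) = ≈-refl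
  fromℤ-neg -[1+ n ]  = ≈-sym (-‿involutive _)

  fromℤ-*-pos : ∀ m n → fromℤ (+ m ℤ.* + n) ≈ fromℤ (+ m) * fromℤ (+ n)
  fromℤ-*-pos m n = begin
    fromℤ (+ m ℤ.* + n)    ≡⟨ cong fromℤ (ℤ.pos-* m n) ⟨
    (m ℕ.* n) ·′ 1#        ≈⟨ ×1-homo-* m n ⟩
    m ·′ 1# * n ·′ 1#      ∎
    where open ≈-Reasoning

  fromℤ-*ʳ : ∀ m j → fromℤ (+ m ℤ.* j) ≈ fromℤ (+ m) * fromℤ j
  fromℤ-*ʳ m (+ n)    = fromℤ-*-pos m n
  fromℤ-*ʳ m -[1+ n ] = begin
    fromℤ (+ m ℤ.* ℤ.- + suc n)     ≡⟨ cong fromℤ (ℤ.neg-distribʳ-* (+ m) (+ suc n)) ⟨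
    fromℤ (ℤ.- (+ m ℤ.* + suc n))   ≈⟨ fromℤ-neg (+ m ℤ.* + suc n) ⟩
    - fromℤ (+ m ℤ.* + suc n)       ≈⟨ -‿cong (fromℤ-*-pos m (suc n)) ⟩
    - (m ·′ 1# * suc n ·′ 1#)       ≈⟨ -‿distribʳ-* _ _ ⟩
    m ·′ 1# * - (suc n ·′ 1#)       ∎
    where open ≈-Reasoning

  fromℤ-* : ∀ i j → fromℤ (i ℤ.* j) ≈ fromℤ i * fromℤ j
  fromℤ-* (+ m)    j = fromℤ-*ʳ m j
  fromℤ-* -[1+ m ] j = begin
    fromℤ (ℤ.- + suc m ℤ.* j)       ≡⟨ cong fromℤ (ℤ.neg-distribˡ-* (+ suc m) j) ⟨
    fromℤ (ℤ.- (+ suc m ℤ.* j))     ≈⟨ fromℤ-neg (+ suc m ℤ.* j) ⟩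
    - fromℤ (+ suc m ℤ.* j)         ≈⟨ -‿cong (fromℤ-*ʳ (suc m) j) ⟩
    - (suc m ·′ 1# * fromℤ j)       ≈⟨ -‿distribˡ-* _ _ ⟩
    - (suc m ·′ 1#) * fromℤ j       ∎
    where open ≈-Reasoning

  ℤ-morphism : ℤ.+-*-rawRing -Raw-AlmostCommutative⟶ fromCommutativeRing A
  ℤ-morphism = record
    { ⟦_⟧    = fromℤ
    ; +-homo = fromℤ-+
    ; *-homo = fromℤ-*
    ; -‿homo = fromℤ-neg
    ; 0-homo = ≈-refl
    ; 1-homo = ≈-refl
    }

  fromℤ-≟ : ∀ i j → Maybe (fromℤ i ≈ fromℤ j)
  fromℤ-≟ i j with i ℤ.≟ j
  ... | yes refl = just ≈-refl
  ... | no  _    = nothing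

  open RingSolver ℤ.+-*-rawRing (fromCommutativeRing A) ℤ-morphism fromℤ-≟ public
    using (Polynomial; solve; _:=_; _:+_; _:-_; _:*_; :-_; con)

  :0 :1 : ∀ {n} → Polynomial n
  :0 = con (+ 0)
  :1 = con (+ 1)

-- Ordered field arithmetic

module RealProperties (R : RealNumbers) where

  open RealNumbers R
  open CommutativeRing commutativeRing public
    using (+-identityˡ; +-identityʳ; +-comm; +-assoc; *-assoc; *-comm; *-identityˡ; *-identityʳ
          ; zeroˡ; zeroʳ; -‿inverseʳ)
  open DecTotalOrder decTotalOrder public
    using () renaming (refl to ≤-refl; reflexive to ≤-reflexive; trans to ≤-trans
                      ; antisym to ≤-antisym; total to ≤-total; _≟_ to _≟ℝ_)
  open IntegerCoefficients commutativeRing public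
  module ≤-Reasoning = PartialOrderReasoning (DecTotalOrder.poset decTotalOrder)
  open ≤-Reasoning

  ≰⇒> : ∀ {x y} → ¬ x ≤ y → y < x
  ≰⇒> {x} {y} x≰y with ≤-total x y
  ... | inj₁ x≤y = contradiction x≤y x≰y
  ... | inj₂ y≤x = y≤x , λ y≡x → x≰y (≤-reflexive (sym y≡x))

  <⇒≱ : ∀ {x y} → x < y → ¬ y ≤ x
  <⇒≱ (x≤y , x≢y) y≤x = x≢y (≤-antisym x≤y y≤x)

  <-≤-trans : ∀ {x y z} → x < y → y ≤ z → x < z
  <-≤-trans x<y y≤z = ≤-trans (proj₁ x<y) y≤z , λ { refl → <⇒≱ x<y y≤z }

  -- Most inequalities below are certified in this form: a nonnegative difference is exhibited, and
  -- the ring solver checks that it is the difference.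
  ≤-by-difference : ∀ {x y d} → 0# ≤ d → y ≡ x + d → x ≤ y
  ≤-by-difference {x} {y} {d} 0≤d y≡x+d = begin
    x       ≡⟨ +-identityʳ x ⟨
    x + 0#  ≤⟨ +-monoʳ-≤ x 0≤d ⟩
    x + d   ≡⟨ y≡x+d ⟨
    y       ∎

  x≤y⇒0≤y-x : ∀ {x y} → x ≤ y → 0# ≤ y - x
  x≤y⇒0≤y-x {x} {y} x≤y = begin
    0#         ≡⟨ -‿inverseʳ x ⟨
    x - x      ≡⟨ +-comm x (- x) ⟩
    - x + x    ≤⟨ +-monoʳ-≤ (- x) x≤y ⟩
    - x + y    ≡⟨ +-comm (- x) y ⟩
    y - x      ∎

  x<y⇒0<y-x : ∀ {x y} → x < y → 0# < y - x
  x<y⇒0<y-x {x} {y} (x≤y , x≢y) = x≤y⇒0≤y-x x≤y , λ 0≡y-x → x≢y (trans (sym (+-identityʳ x))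
    (trans (cong (x +_) 0≡y-x) (solve 2 (λ x y → x :+ (y :- x) := y) refl x y)))

  +-nonneg : ∀ {x y} → 0# ≤ x → 0# ≤ y → 0# ≤ x + y
  +-nonneg {x} {y} 0≤x 0≤y = ≤-trans 0≤x (≤-by-difference 0≤y refl)

  +-mono-≤ : ∀ {w x y z} → w ≤ x → y ≤ z → w + y ≤ x + z
  +-mono-≤ {w} {x} {y} {z} w≤x y≤z =
    ≤-by-difference (+-nonneg (x≤y⇒0≤y-x w≤x) (x≤y⇒0≤y-x y≤z))
      (solve 4 (λ w x y z → x :+ z := w :+ y :+ ((x :- w) :+ (z :- y))) refl w x y z)

  *-monoʳ-≤ : ∀ {x y z} → 0# ≤ x → y ≤ z → x * y ≤ x * z
  *-monoʳ-≤ {x} {y} {z} 0≤x y≤z = ≤-by-difference (*-nonneg 0≤x (x≤y⇒0≤y-x y≤z))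
    (solve 3 (λ x y z → x :* z := x :* y :+ x :* (z :- y)) refl x y z)

  *-monoˡ-≤ : ∀ {x y z} → 0# ≤ x → y ≤ z → y * x ≤ z * x
  *-monoˡ-≤ {x} {y} {z} 0≤x y≤z = subst₂ _≤_ (*-comm x y) (*-comm x z) (*-monoʳ-≤ 0≤x y≤z)

  *-mono-≤ : ∀ {w x y z} → 0# ≤ w → w ≤ x → 0# ≤ y → y ≤ z → w * y ≤ x * z
  *-mono-≤ 0≤w w≤x 0≤y y≤z = ≤-trans (*-monoˡ-≤ 0≤y w≤x) (*-monoʳ-≤ (≤-trans 0≤w w≤x) y≤z)

  0≤1 : 0# ≤ 1#
  0≤1 with ≤-total 0# 1#
  ... | inj₁ 0≤1 = 0≤1
  ... | inj₂ 1≤0 = subst (0# ≤_) (solve 0 ((:0 :- :1) :* (:0 :- :1) := :1) refl)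
                     (*-nonneg (x≤y⇒0≤y-x 1≤0) (x≤y⇒0≤y-x 1≤0))

  0<1 : 0# < 1#
  0<1 = 0≤1 , 0≢1

  0<⇒≢0 : ∀ {x} → 0# < x → x ≢ 0#
  0<⇒≢0 (_ , 0≢x) x≡0 = 0≢x (sym x≡0)

  *-cancelˡ-≡ : ∀ {z x y} → z ≢ 0# → z * x ≡ z * y → x ≡ y
  *-cancelˡ-≡ {z} {x} {y} z≢0 zx≡zy = trans (insert x) (trans (cong (z ⁻¹ *_) zx≡zy) (sym (insert y)))
    where
    insert : ∀ w → w ≡ z ⁻¹ * (z * w)
    insert w = trans (sym (*-identityʳ w)) (trans (cong (w *_) (sym (*-inverseʳ z z≢0)))
      (solve 3 (λ w z i → w :* (z :* i) := i :* (z :* w)) refl w z (z ⁻¹)))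

  *-pos : ∀ {x y} → 0# < x → 0# < y → 0# < x * y
  *-pos {x} {y} 0<x 0<y = *-nonneg (proj₁ 0<x) (proj₁ 0<y) , λ 0≡xy →
    0<⇒≢0 0<y (*-cancelˡ-≡ (0<⇒≢0 0<x) (trans (sym 0≡xy) (sym (zeroʳ x))))

  +-pos : ∀ {x y} → 0# < x → 0# ≤ y → 0# < x + y
  +-pos 0<x 0≤y = <-≤-trans 0<x (≤-by-difference 0≤y refl)

  *-cancelˡ-≤ : ∀ {z x y} → 0# < z → z * x ≤ z * y → x ≤ y
  *-cancelˡ-≤ {z} {x} {y} 0<z zx≤zy with x ≤? y
  ... | yes x≤y = x≤y
  ... | no  x≰y = contradiction zx≤zy (<⇒≱
    (*-monoʳ-≤ (proj₁ 0<z) (proj₁ (≰⇒> x≰y)) , λ zy≡zx →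
      x≰y (≤-reflexive (sym (*-cancelˡ-≡ (0<⇒≢0 0<z) zy≡zx)))))

  0<*⇒0< : ∀ {x y} → 0# < x → 0# < x * y → 0# < y
  0<*⇒0< {x} {y} 0<x 0<xy =
    *-cancelˡ-≤ 0<x (≤-trans (≤-reflexive (zeroʳ x)) (proj₁ 0<xy)) ,
    λ { refl → 0<⇒≢0 0<xy (zeroʳ x) }

  ⁻¹-pos : ∀ {x} → 0# < x → 0# < x ⁻¹
  ⁻¹-pos {x} 0<x = 0<*⇒0< 0<x (subst (0# <_) (sym (*-inverseʳ x (0<⇒≢0 0<x))) 0<1)

  x*[y/x]≡y : ∀ {x} y → 0# < x → x * (y / x) ≡ y
  x*[y/x]≡y {x} y 0<x = trans (solve 3 (λ x y i → x :* (y :* i) := y :* (x :* i)) refl x y (x ⁻¹))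
    (trans (cong (y *_) (*-inverseʳ x (0<⇒≢0 0<x))) (*-identityʳ y))

  ≤*⇒/≤ : ∀ {x y z} → 0# < x → y ≤ x * z → y / x ≤ z
  ≤*⇒/≤ 0<x y≤xz = *-cancelˡ-≤ 0<x (≤-trans (≤-reflexive (x*[y/x]≡y _ 0<x)) y≤xz)

  *≤⇒≤/ : ∀ {x y z} → 0# < x → x * z ≤ y → z ≤ y / x
  *≤⇒≤/ 0<x xz≤y = *-cancelˡ-≤ 0<x (≤-trans xz≤y (≤-reflexive (sym (x*[y/x]≡y _ 0<x))))

  fromℕ-nonneg : ∀ n → 0# ≤ fromℕ n
  fromℕ-nonneg zero    = ≤-refl
  fromℕ-nonneg (suc n) = +-nonneg 0≤1 (fromℕ-nonneg n)

  fromℕ-pos : ∀ n → 0# < fromℕ (suc n)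
  fromℕ-pos n = +-pos 0<1 (fromℕ-nonneg n)

  fromℕ-mono-≤ : ∀ {m n} → m ℕ.≤ n → fromℕ m ≤ fromℕ n
  fromℕ-mono-≤ {n = n} z≤n = fromℕ-nonneg n
  fromℕ-mono-≤ (s≤s m≤n)   = +-monoʳ-≤ 1# (fromℕ-mono-≤ m≤n)

  -- The search runs downwards from an Archimedean bound; decidability of `_≤_` tells where to stop.
  floor : ∀ {x} → 0# ≤ x → ∃[ n ] (fromℕ n ≤ x × x ≤ fromℕ (suc n))
  floor {x} 0≤x = search (proj₁ (archimedean x)) (proj₂ (archimedean x))
    where
    search : ∀ n → x ≤ fromℕ n → ∃[ n ] (fromℕ n ≤ x × x ≤ fromℕ (suc n))
    search zero    x≤0 = 0 , 0≤x , ≤-trans x≤0 (fromℕ-nonneg 1)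
    search (suc n) x≤1+n with x ≤? fromℕ n
    ... | yes x≤n = search n x≤n
    ... | no  x≰n = n , proj₁ (≰⇒> x≰n) , x≤1+n

  -- Exponential, logarithm and real powers

  exp-0 : exp 0# ≡ 1#
  exp-0 = *-cancelˡ-≡ (0<⇒≢0 0<e) (begin-equality
    exp 0# * exp 0#  ≡⟨ exp-+ 0# 0# ⟨
    exp (0# + 0#)    ≡⟨ cong exp (+-identityʳ 0#) ⟩
    exp 0#           ≡⟨ *-identityʳ _ ⟨
    exp 0# * 1#      ∎)
    where
    0<e : 0# < exp 0#
    0<e = <-≤-trans 0<1 (≤-trans (≤-reflexive (sym (+-identityʳ 1#))) (1+x≤exp-x 0#))

  exp-neg : ∀ x → exp x * exp (- x) ≡ 1#
  exp-neg x = trans (sym (exp-+ x (- x))) (trans (cong exp (-‿inverseʳ x)) exp-0)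

  exp-pos : ∀ x → 0# < exp x
  exp-pos x with ≤-total 0# x
  ... | inj₁ 0≤x = <-≤-trans (+-pos 0<1 0≤x) (1+x≤exp-x x)
  ... | inj₂ x≤0 = 0<*⇒0< (<-≤-trans (+-pos 0<1 0≤-x) (1+x≤exp-x (- x)))
                     (subst (0# <_) (trans (sym (exp-neg x)) (*-comm _ _)) 0<1)
    where
    0≤-x : 0# ≤ - x
    0≤-x = ≤-trans (x≤y⇒0≤y-x x≤0) (≤-reflexive (+-identityˡ (- x)))

  -- The functional equation moves the tangent at 0 to any point `w`. Monotonicity and convexity of
  -- `exp` are both drawn from this.
  exp-tangent : ∀ w z → exp w * (1# + (z - w)) ≤ exp z
  exp-tangent w z = begin
    exp w * (1# + (z - w))  ≤⟨ *-monoʳ-≤ (proj₁ (exp-pos w)) (1+x≤exp-x (z - w)) ⟩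
    exp w * exp (z - w)     ≡⟨ exp-+ w (z - w) ⟨
    exp (w + (z - w))       ≡⟨ cong exp (solve 2 (λ w z → w :+ (z :- w) := z) refl w z) ⟩
    exp z                   ∎

  exp-mono-≤ : ∀ {x y} → x ≤ y → exp x ≤ exp y
  exp-mono-≤ {x} {y} x≤y = ≤-trans
    (≤-by-difference (*-nonneg (proj₁ (exp-pos x)) (x≤y⇒0≤y-x x≤y))
      (solve 2 (λ e d → e :* (:1 :+ d) := e :+ e :* d) refl (exp x) (y - x)))
    (exp-tangent x y)

  exp-cancel-≤ : ∀ {x y} → exp x ≤ exp y → x ≤ y
  exp-cancel-≤ {x} {y} ex≤ey with x ≤? y
  ... | yes x≤y = x≤y
  ... | no  x≰y = contradiction
    (≤-trans (exp-tangent y x) (≤-trans ex≤ey (≤-reflexive (sym (*-identityʳ _)))))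
    λ le → <⇒≱ (x<y⇒0<y-x (≰⇒> x≰y)) (+-cancel (*-cancelˡ-≤ (exp-pos y) le))
    where
    +-cancel : ∀ {d} → 1# + d ≤ 1# → d ≤ 0#
    +-cancel {d} le = ≤-by-difference (x≤y⇒0≤y-x le)
      (solve 1 (λ d → :0 := d :+ (:1 :- (:1 :+ d))) refl d)

  exp-injective : ∀ {x y} → exp x ≡ exp y → x ≡ y
  exp-injective eq =
    ≤-antisym (exp-cancel-≤ (≤-reflexive eq)) (exp-cancel-≤ (≤-reflexive (sym eq)))

  -- Convexity: the tangent at `a * z` is evaluated at `z` with weight `a` and at `0#` with weight
  -- `1# - a`, and the slope terms cancel. In terms of `exp z` this is Bernoulli's inequality for
  -- exponents in [0, 1], from which powers inherit their concavity.
  exp-chord : ∀ {a} z → 0# ≤ a → a ≤ 1# → exp (a * z) ≤ 1# + a * (exp z - 1#)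
  exp-chord {a} z 0≤a a≤1 = ≤-by-difference
    (+-nonneg (*-nonneg 0≤a (x≤y⇒0≤y-x (exp-tangent (a * z) z)))
              (*-nonneg (x≤y⇒0≤y-x a≤1) (x≤y⇒0≤y-x (exp-tangent (a * z) 0#))))
    (trans (cong (λ o → 1# + a * (exp z - o)) (sym exp-0))
    (trans (cong (λ o → o + a * (exp z - exp 0#)) (sym exp-0))
    (solve 5 (λ a z w e e₀ → e₀ :+ a :* (e :- e₀) :=
        w :+ (a :* (e :- w :* (:1 :+ (z :- a :* z)))
          :+ (:1 :- a) :* (e₀ :- w :* (:1 :+ (:0 :- a :* z)))))
      refl a z (exp (a * z)) (exp z) (exp 0#))))

  log-exp : ∀ x → log (exp x) ≡ x
  log-exp x = exp-injective (exp-log (exp-pos x))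

  log-* : ∀ {x y} → 0# < x → 0# < y → log (x * y) ≡ log x + log y
  log-* {x} {y} 0<x 0<y = exp-injective (begin-equality
    exp (log (x * y))        ≡⟨ exp-log (*-pos 0<x 0<y) ⟩
    x * y                    ≡⟨ cong₂ _*_ (exp-log 0<x) (exp-log 0<y) ⟨
    exp (log x) * exp (log y) ≡⟨ exp-+ _ _ ⟨
    exp (log x + log y)      ∎)

  log-mono-≤ : ∀ {x y} → 0# < x → x ≤ y → log x ≤ log y
  log-mono-≤ 0<x x≤y = exp-cancel-≤
    (subst₂ _≤_ (sym (exp-log 0<x)) (sym (exp-log (<-≤-trans 0<x x≤y))) x≤y)

  ^≡exp : ∀ {x} a → 0# < x → x ^ a ≡ exp (a * log x)
  ^≡exp {x} a 0<x with x ≤? 0#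
  ... | yes x≤0 = contradiction x≤0 (<⇒≱ 0<x)
  ... | no  _   = refl

  0^a≡0 : ∀ a → 0# ^ a ≡ 0#
  0^a≡0 a with 0# ≤? 0#
  ... | yes _   = refl
  ... | no  0≰0 = contradiction ≤-refl 0≰0

  ^-pos : ∀ {x} a → 0# < x → 0# < x ^ a
  ^-pos a 0<x = subst (0# <_) (sym (^≡exp a 0<x)) (exp-pos _)

  -- The value of `_^_` at base 0 is set apart from the exponential formula. Matching on this view
  -- replaces the base by `0#` or supplies the positivity that the formula requires.
  data NonNeg : ℝ → Set where
    zero : NonNeg 0#
    pos  : ∀ {x} → 0# < x → NonNeg x

  nonNeg : ∀ {x} → 0# ≤ x → NonNeg x
  nonNeg {x} 0≤x with x ≟ℝ 0#
  ... | yes refl = zero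
  ... | no  x≢0  = pos (0≤x , λ 0≡x → x≢0 (sym 0≡x))

  ^-nonneg : ∀ {x} a → 0# ≤ x → 0# ≤ x ^ a
  ^-nonneg a 0≤x with nonNeg 0≤x
  ... | zero    = ≤-reflexive (sym (0^a≡0 a))
  ... | pos 0<x = proj₁ (^-pos a 0<x)

  ^-mono-≤ : ∀ {a x y} → 0# ≤ a → 0# ≤ x → x ≤ y → x ^ a ≤ y ^ a
  ^-mono-≤ {a} 0≤a 0≤x x≤y with nonNeg 0≤x
  ... | zero    = ≤-trans (≤-reflexive (0^a≡0 a)) (^-nonneg a x≤y)
  ... | pos 0<x = subst₂ _≤_ (sym (^≡exp a 0<x)) (sym (^≡exp a (<-≤-trans 0<x x≤y)))
                    (exp-mono-≤ (*-monoʳ-≤ 0≤a (log-mono-≤ 0<x x≤y)))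

  *-^-pos : ∀ {x y} a → 0# < x → 0# < y → (x * y) ^ a ≡ x ^ a * y ^ a
  *-^-pos {x} {y} a 0<x 0<y = begin-equality
    (x * y) ^ a                        ≡⟨ ^≡exp a (*-pos 0<x 0<y) ⟩
    exp (a * log (x * y))              ≡⟨ cong (λ l → exp (a * l)) (log-* 0<x 0<y) ⟩
    exp (a * (log x + log y))          ≡⟨ cong exp (solve 3 (λ a l m → a :* (l :+ m) := a :* l :+ a :* m) refl a _ _) ⟩
    exp (a * log x + a * log y)        ≡⟨ exp-+ _ _ ⟩
    exp (a * log x) * exp (a * log y)  ≡⟨ cong₂ _*_ (^≡exp a 0<x) (^≡exp a 0<y) ⟨
    x ^ a * y ^ a                      ∎

  *-^ : ∀ {x y} a → 0# < x → 0# ≤ y → (x * y) ^ a ≡ x ^ a * y ^ a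
  *-^ {x} a 0<x 0≤y with nonNeg 0≤y
  ... | pos 0<y = *-^-pos a 0<x 0<y
  ... | zero    = begin-equality
    (x * 0#) ^ a      ≡⟨ cong (_^ a) (zeroʳ x) ⟩
    0# ^ a            ≡⟨ 0^a≡0 a ⟩
    0#                ≡⟨ zeroʳ _ ⟨
    x ^ a * 0#        ≡⟨ cong (x ^ a *_) (0^a≡0 a) ⟨
    x ^ a * 0# ^ a    ∎

  1^a≡1 : ∀ a → 1# ^ a ≡ 1#
  1^a≡1 a = trans (^≡exp a 0<1) (trans (cong exp (trans (cong (a *_) log-1) (zeroʳ a))) exp-0)
    where
    log-1 : log 1# ≡ 0#
    log-1 = trans (cong log (sym exp-0)) (log-exp 0#)

  ^-neg-inverse : ∀ {x} a → 0# < x → x ^ (- a) * x ^ a ≡ 1#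
  ^-neg-inverse {x} a 0<x = begin-equality
    x ^ (- a) * x ^ a                      ≡⟨ cong₂ _*_ (^≡exp (- a) 0<x) (^≡exp a 0<x) ⟩
    exp (- a * log x) * exp (a * log x)    ≡⟨ *-comm _ _ ⟩
    exp (a * log x) * exp (- a * log x)    ≡⟨ cong (λ l → exp (a * log x) * exp l)
                                                (solve 2 (λ a l → :- a :* l := :- (a :* l)) refl a (log x)) ⟩
    exp (a * log x) * exp (- (a * log x))  ≡⟨ exp-neg _ ⟩
    1#                                     ∎

  -- The tangent line of z ↦ z ^ a at u, multiplied by u to avoid a division.
  ^-tangent : ∀ {a u z} → 0# ≤ a → a ≤ 1# → 0# < u → 0# ≤ z →
              z ^ a * u ≤ u ^ a * (u + a * (z - u))
  ^-tangent {a} {u} 0≤a a≤1 0<u 0≤z with nonNeg 0≤z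
  ... | zero = begin
    0# ^ a * u                    ≡⟨ trans (cong (_* u) (0^a≡0 a)) (zeroˡ u) ⟩
    0#                            ≤⟨ *-nonneg (proj₁ (^-pos a 0<u)) (*-nonneg (proj₁ 0<u) (x≤y⇒0≤y-x a≤1)) ⟩
    u ^ a * (u * (1# - a))        ≡⟨ cong (u ^ a *_) (solve 2 (λ u a → u :* (:1 :- a) := u :+ a :* (:0 :- u)) refl u a) ⟩
    u ^ a * (u + a * (0# - u))    ∎
  ... | pos {z} 0<z = begin
    z ^ a * u                                    ≡⟨ cong (_* u) z^a ⟩
    u ^ a * exp (a * d) * u                      ≡⟨ *-assoc _ _ _ ⟩
    u ^ a * (exp (a * d) * u)                    ≤⟨ *-monoʳ-≤ (proj₁ (^-pos a 0<u)) (*-monoˡ-≤ (proj₁ 0<u) (exp-chord d 0≤a a≤1)) ⟩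
    u ^ a * ((1# + a * (exp d - 1#)) * u)        ≡⟨ cong (u ^ a *_)
      (solve 3 (λ u a e → (:1 :+ a :* (e :- :1)) :* u := u :+ a :* (u :* e :- u)) refl u a (exp d)) ⟩
    u ^ a * (u + a * (u * exp d - u))            ≡⟨ cong (λ w → u ^ a * (u + a * (w - u))) (sym z≡ue) ⟩
    u ^ a * (u + a * (z - u))                    ∎
    where
    d = log z - log u
    u+d : log u + d ≡ log z
    u+d = solve 2 (λ l m → l :+ (m :- l) := m) refl (log u) (log z)
    z≡ue : z ≡ u * exp d
    z≡ue = begin-equality
      z                     ≡⟨ exp-log 0<z ⟨
      exp (log z)           ≡⟨ cong exp u+d ⟨
      exp (log u + d)       ≡⟨ exp-+ _ _ ⟩
      exp (log u) * exp d   ≡⟨ cong (_* exp d) (exp-log 0<u) ⟩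
      u * exp d             ∎
    z^a : z ^ a ≡ u ^ a * exp (a * d)
    z^a = begin-equality
      z ^ a                              ≡⟨ cong (_^ a) z≡ue ⟩
      (u * exp d) ^ a                    ≡⟨ *-^-pos a 0<u (exp-pos d) ⟩
      u ^ a * exp d ^ a                  ≡⟨ cong (u ^ a *_) (^≡exp a (exp-pos d)) ⟩
      u ^ a * exp (a * log (exp d))      ≡⟨ cong (λ l → u ^ a * exp (a * l)) (log-exp d) ⟩
      u ^ a * exp (a * d)                ∎

-- Finite sums and expectations

module SumProperties (R : RealNumbers) where

  open RealNumbers R
  open RealProperties R
  open SemiringSum (CommutativeRing.semiring commutativeRing) public
    using (sum; sum-cong-≗; sum-replicate-zero; sum-init-last; *-distribˡ-sum; *-distribʳ-sum)
  open CommutativeMonoidSum (CommutativeRing.+-commutativeMonoid commutativeRing) public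
    using (∑-distrib-+; ∑-comm)
  open ≤-Reasoning

  sum-mono-≤ : ∀ {n} {x y : Fin n → ℝ} → (∀ i → x i ≤ y i) → sum x ≤ sum y
  sum-mono-≤ {zero}  x≤y = ≤-refl
  sum-mono-≤ {suc n} x≤y = +-mono-≤ (x≤y zero) (sum-mono-≤ (λ i → x≤y (suc i)))

  fromℕ*≡sum : ∀ n {c} → fromℕ n * c ≡ sum {n} (λ _ → c)
  fromℕ*≡sum zero    {c} = zeroˡ c
  fromℕ*≡sum (suc n) {c} = trans
    (solve 2 (λ m c → (:1 :+ m) :* c := c :+ m :* c) refl (fromℕ n) c) (cong (c +_) (fromℕ*≡sum n))

  sum-increment : ∀ {n} (i : Fin n) {x y : Fin n → ℝ} →
                  x i ≡ 1# + y i → (∀ j → j ≢ i → x j ≡ y j) → sum x ≡ 1# + sum y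
  sum-increment zero {y = y} xᵢ xⱼ = trans
    (cong₂ _+_ xᵢ (sum-cong-≗ (λ j → xⱼ (suc j) λ ()))) (+-assoc 1# (y zero) _)
  sum-increment (suc i) {y = y} xᵢ xⱼ = trans
    (cong₂ _+_ (xⱼ zero λ ()) (sum-increment i xᵢ (λ j j≢i → xⱼ (suc j) (λ eq → j≢i (Fin.suc-injective eq)))))
    (solve 2 (λ a b → a :+ (:1 :+ b) := :1 :+ (a :+ b)) refl (y zero) (sum (λ j → y (suc j))))

  -- The averaging argument in constructive form: when the comparison fails at the head, subtracting
  -- it leaves the hypothesis for the tails.
  sum≤⇒∃≤ : ∀ {n} {x y : Fin (suc n) → ℝ} → sum x ≤ sum y → ∃[ i ] x i ≤ y i
  sum≤⇒∃≤ {n} {x} {y} Σx≤Σy with x zero ≤? y zero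
  sum≤⇒∃≤ {n} Σx≤Σy | yes x₀≤y₀ = zero , x₀≤y₀
  sum≤⇒∃≤ {zero} {x} {y} Σx≤Σy | no x₀≰y₀ =
    contradiction (subst₂ _≤_ (+-identityʳ (x zero)) (+-identityʳ (y zero)) Σx≤Σy) x₀≰y₀
  sum≤⇒∃≤ {suc n} {x} {y} Σx≤Σy | no x₀≰y₀ =
    let i , xᵢ≤yᵢ = sum≤⇒∃≤ {x = λ i → x (suc i)} {y = λ i → y (suc i)} tails in suc i , xᵢ≤yᵢ
    where
    Σx′ = sum (λ i → x (suc i))
    Σy′ = sum (λ i → y (suc i))
    tails : Σx′ ≤ Σy′
    tails = ≤-by-difference
      (+-nonneg (x≤y⇒0≤y-x Σx≤Σy) (x≤y⇒0≤y-x (proj₁ (≰⇒> x₀≰y₀))))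
      (solve 4 (λ a b c d → d := c :+ ((b :+ d :- (a :+ c)) :+ (a :- b))) refl
        (x zero) (y zero) Σx′ Σy′)

  module Expectation {n} (w : Fin n → ℝ) (w-nonneg : ∀ i → 0# ≤ w i) (w-sum : sum w ≡ 1#) where

    𝔼 : (Fin n → ℝ) → ℝ
    𝔼 x = sum λ i → w i * x i

    𝔼-const : ∀ c → 𝔼 (λ _ → c) ≡ c
    𝔼-const c = trans (sym (*-distribʳ-sum c w)) (trans (cong (_* c) w-sum) (*-identityˡ c))

    𝔼-mono-≤ : ∀ {x y} → (∀ i → x i ≤ y i) → 𝔼 x ≤ 𝔼 y
    𝔼-mono-≤ x≤y = sum-mono-≤ λ i → *-monoʳ-≤ (w-nonneg i) (x≤y i)

    𝔼-affine : ∀ a b x → 𝔼 (λ i → a + b * x i) ≡ a + b * 𝔼 x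
    𝔼-affine a b x = begin-equality
      𝔼 (λ i → a + b * x i)
        ≡⟨ sum-cong-≗ (λ i → solve 4 (λ w a b x → w :* (a :+ b :* x) := w :* a :+ b :* (w :* x)) refl (w i) a b (x i)) ⟩
      sum (λ i → w i * a + b * (w i * x i))
        ≡⟨ ∑-distrib-+ (λ i → w i * a) (λ i → b * (w i * x i)) ⟩
      𝔼 (λ _ → a) + sum (λ i → b * (w i * x i))
        ≡⟨ cong₂ _+_ (𝔼-const a) (sym (*-distribˡ-sum b (λ i → w i * x i))) ⟩
      a + b * 𝔼 x
        ∎

module LowerBound (R : RealNumbers) where

  open RealNumbers R
  open Bandits R
  open RealProperties R
  open SumProperties R
  open ≤-Reasoning

  -- The power reward and its partial sums

  module PowerReward (β : ℝ) (0<β : 0# < β) (β≤1 : β ≤ 1#) where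

    private
      0≤β = proj₁ 0<β

    p : ℕ → ℝ
    p n = fromℕ n ^ β

    p-nonneg : ∀ n → 0# ≤ p n
    p-nonneg n = ^-nonneg β (fromℕ-nonneg n)

    p-mono-≤ : ∀ {m n} → m ℕ.≤ n → p m ≤ p n
    p-mono-≤ {m} m≤n = ^-mono-≤ 0≤β (fromℕ-nonneg m) (fromℕ-mono-≤ m≤n)

    -- The tangent at the midpoint `n + 1` lies above the curve at `n` and at `n + 2`; in the sum of
    -- the two inequalities the slopes cancel.
    p-diminishing : ∀ n → p (suc (suc n)) - p (suc n) ≤ p (suc n) - p n
    p-diminishing n = *-cancelˡ-≤ (fromℕ-pos n) (≤-by-difference
      (+-nonneg (x≤y⇒0≤y-x (^-tangent 0≤β β≤1 (fromℕ-pos n) (fromℕ-nonneg (suc (suc n)))))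
                (x≤y⇒0≤y-x (^-tangent 0≤β β≤1 (fromℕ-pos n) (fromℕ-nonneg n))))
      (solve 5 (λ N b p₀ p₁ p₂ →
          let u = :1 :+ N in
          u :* (p₁ :- p₀) := u :* (p₂ :- p₁)
            :+ ((p₁ :* (u :+ b :* ((:1 :+ u) :- u)) :- p₂ :* u)
            :+ (p₁ :* (u :+ b :* (N :- u)) :- p₀ :* u)))
        refl (fromℕ n) β (p n) (p (suc n)) (p (suc (suc n)))))

    -- The recursion adds the last term, as inductions on the number of pulls require, whereas `sum`
    -- splits off the first; `sum-p≡S` reconciles the two.
    S : ℕ → ℝ
    S zero    = 0#
    S (suc n) = S n + p (suc n)

    S-nonneg : ∀ n → 0# ≤ S n
    S-nonneg zero    = ≤-refl
    S-nonneg (suc n) = +-nonneg (S-nonneg n) (p-nonneg (suc n))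

    S-step : ∀ n → S n ≤ S (suc n)
    S-step n = ≤-by-difference (p-nonneg (suc n)) refl

    S-mono-≤ : ∀ {m n} → m ℕ.≤ n → S m ≤ S n
    S-mono-≤ {n = n} z≤n = S-nonneg n
    S-mono-≤ {m} {suc n} m≤1+n with ℕ.m≤n⇒m<n∨m≡n m≤1+n
    ... | inj₁ (s≤s m≤n) = ≤-trans (S-mono-≤ m≤n) (S-step n)
    ... | inj₂ refl      = ≤-refl

    S-pos : ∀ {n} → 1 ℕ.≤ n → 0# < S n
    S-pos {suc n} _ = subst (0# <_) (+-comm _ _) (+-pos (^-pos β (fromℕ-pos n)) (S-nonneg n))

    -- The tangent at `n` gives `p (n + 1) n ≤ p n (n + β)`. Multiplying by `n - β`, which is
    -- nonnegative for `n ≥ 1` because `β ≤ 1`, leaves `n² - β² ≤ n²`. At `n = 0` the left side is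
    -- not positive.
    p-suc-bound : ∀ n → p (suc n) * (fromℕ n - β) ≤ p n * fromℕ n
    p-suc-bound zero = begin
      p 1 * (0# - β)   ≤⟨ ≤-by-difference (*-nonneg (p-nonneg 1) 0≤β)
                            (solve 2 (λ q b → :0 := q :* (:0 :- b) :+ q :* b) refl (p 1) β) ⟩
      0#               ≡⟨ zeroʳ _ ⟨
      p 0 * 0#         ∎
    p-suc-bound n@(suc m) = *-cancelˡ-≤ (fromℕ-pos m) (≤-by-difference
      (+-nonneg (*-nonneg (x≤y⇒0≤y-x β≤N)
                          (x≤y⇒0≤y-x (^-tangent 0≤β β≤1 (fromℕ-pos m) (fromℕ-nonneg (suc n)))))
                (*-nonneg (p-nonneg n) (*-nonneg 0≤β 0≤β)))
      (solve 4 (λ N b p₀ p₁ → N :* (p₀ :* N) := N :* (p₁ :* (N :- b))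
          :+ ((N :- b) :* (p₀ :* (N :+ b :* ((:1 :+ N) :- N)) :- p₁ :* N) :+ p₀ :* (b :* b)))
        refl (fromℕ n) β (p n) (p (suc n))))
      where
      β≤N : β ≤ fromℕ n
      β≤N = ≤-trans β≤1 (≤-by-difference (fromℕ-nonneg m) refl)

    -- The discrete counterpart of integrating `t ^ β`. The left side grows by at most
    -- `(β + 1) p (n + 1)` in each step, which is `p-suc-bound` rearranged.
    S-lower : ∀ n → fromℕ n * p n ≤ (β + 1#) * S n
    S-lower zero    = ≤-reflexive (trans (zeroˡ _) (sym (zeroʳ _)))
    S-lower (suc n) = ≤-by-difference
      (+-nonneg (x≤y⇒0≤y-x (S-lower n)) (x≤y⇒0≤y-x (p-suc-bound n)))
      (solve 5 (λ N b p₀ p₁ s → (b :+ :1) :* (s :+ p₁) := (:1 :+ N) :* p₁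
          :+ (((b :+ :1) :* s :- N :* p₀) :+ (p₀ :* N :- p₁ :* (N :- b))))
        refl (fromℕ n) β (p n) (p (suc n)) (S n))

    sum-p≡S : ∀ n → sum {n} (λ t → p (suc (toℕ t))) ≡ S n
    sum-p≡S zero    = refl
    sum-p≡S (suc n) = trans (sum-init-last (λ (t : Fin (suc n)) → p (suc (toℕ t)))) (cong₂ _+_
      (trans (sum-cong-≗ λ (t : Fin n) → cong (λ m → p (suc m)) (Fin.toℕ-inject₁ t)) (sum-p≡S n))
      (cong (λ m → p (suc m)) (Fin.toℕ-fromℕ n)))

  -- The hard instance

  module HardInstance (β : ℝ) (0<β : 0# < β) (β≤1 : β ≤ 1#) (τ : ℕ) {k : ℕ} where

    open PowerReward β 0<β β≤1
    open Extrema (DecTotalOrder.totalOrder decTotalOrder) using (xs≤max)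

    private
      0≤β = proj₁ 0<β

    g : ℕ → ℝ
    g t = p (t ℕ.⊓ τ)

    g≤pτ : ∀ t → g t ≤ p τ
    g≤pτ t = p-mono-≤ (ℕ.m⊓n≤n t τ)

    g≡p : ∀ {t} → t ℕ.≤ τ → g t ≡ p t
    g≡p t≤τ = cong p (ℕ.m≤n⇒m⊓n≡m t≤τ)

    g≡pτ : ∀ {t} → τ ℕ.≤ t → g t ≡ p τ
    g≡pτ τ≤t = cong p (ℕ.m≥n⇒m⊓n≡n τ≤t)

    -- Capping bends the curve only downwards. Up to `τ` the increments are those of `p`; once
    -- `τ ≤ suc t` the next increment vanishes, while the previous one is nonnegative.
    g-diminishing : ∀ t → g (suc (suc t)) - g (suc t) ≤ g (suc t) - g t
    g-diminishing t with ℕ.≤-total (suc (suc t)) τ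
    ... | inj₁ t+2≤τ = begin
      g (suc (suc t)) - g (suc t)  ≡⟨ cong₂ _-_ (g≡p t+2≤τ) (g≡p t+1≤τ) ⟩
      p (suc (suc t)) - p (suc t)  ≤⟨ p-diminishing t ⟩
      p (suc t) - p t              ≡⟨ cong₂ _-_ (g≡p t+1≤τ) (g≡p (ℕ.<⇒≤ t+1≤τ)) ⟨
      g (suc t) - g t              ∎
      where t+1≤τ = ℕ.<⇒≤ t+2≤τ
    ... | inj₂ τ≤t+2 with ℕ.m≤n⇒m<n∨m≡n τ≤t+2
    ...   | inj₂ refl = begin
      g (suc (suc t)) - g (suc t)  ≡⟨ cong₂ _-_ (g≡p ℕ.≤-refl) (g≡p (ℕ.n≤1+n _)) ⟩
      p (suc (suc t)) - p (suc t)  ≤⟨ p-diminishing t ⟩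
      p (suc t) - p t              ≡⟨ cong₂ _-_ (g≡p (ℕ.n≤1+n _)) (g≡p (ℕ.m≤n+m t 2)) ⟨
      g (suc t) - g t              ∎
    ...   | inj₁ (s≤s τ≤t+1) = begin
      g (suc (suc t)) - g (suc t)  ≡⟨ cong₂ _-_ (g≡pτ τ≤t+2) (g≡pτ τ≤t+1) ⟩
      p τ - p τ                    ≡⟨ -‿inverseʳ (p τ) ⟩
      0#                           ≤⟨ x≤y⇒0≤y-x (g≤pτ t) ⟩
      p τ - g t                    ≡⟨ cong (_- g t) (g≡pτ τ≤t+1) ⟨
      g (suc t) - g t              ∎

    -- The decision is an argument, so that each law of the instance can be proved by matching on
    -- it.
    arm : ∀ {i j : Fin k} → Dec (i ≡ j) → ℕ → ℝ
    arm (yes _) = p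
    arm (no  _) = g

    instance-with-best : Fin k → Instance k
    instance-with-best j = record
      { f           = λ i → arm (i Fin.≟ j)
      ; f-nonneg    = λ i → nonneg (i Fin.≟ j)
      ; f-mono      = λ i → mono (i Fin.≟ j)
      ; f-zero      = λ i → at-zero (i Fin.≟ j)
      ; diminishing = λ i → diminishing (i Fin.≟ j)
      }
      where
      module _ {i : Fin k} where
        nonneg : ∀ (d : Dec (i ≡ j)) t → 0# ≤ arm d t
        nonneg (yes _) t = p-nonneg t
        nonneg (no  _) t = p-nonneg (t ℕ.⊓ τ)

        mono : ∀ (d : Dec (i ≡ j)) t → arm d t ≤ arm d (suc t)
        mono (yes _) t = p-mono-≤ (ℕ.n≤1+n t)
        mono (no  _) t = p-mono-≤ (ℕ.⊓-monoˡ-≤ τ (ℕ.n≤1+n t))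

        at-zero : ∀ (d : Dec (i ≡ j)) → arm d 0 ≡ 0#
        at-zero (yes _) = 0^a≡0 β
        at-zero (no  _) = 0^a≡0 β

        diminishing : ∀ (d : Dec (i ≡ j)) t →
                      arm d (suc (suc t)) - arm d (suc t) ≤ arm d (suc t) - arm d t
        diminishing (yes _) = p-diminishing
        diminishing (no  _) = g-diminishing

    module _ (j : Fin k) where

      open Instance (instance-with-best j) using (f)

      f-best : ∀ t → f j t ≡ p t
      f-best t with j Fin.≟ j
      ... | yes _   = refl
      ... | no  j≢j = contradiction refl j≢j

      f-other : ∀ {i} → i ≢ j → ∀ t → f i t ≡ g t
      f-other {i} i≢j t with i Fin.≟ j
      ... | yes i≡j = contradiction i≡j i≢j
      ... | no  _   = refl

      cumulative-best : ∀ T → cumulative (instance-with-best j) j T ≡ S T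
      cumulative-best T = trans (sum-cong-≗ λ (t : Fin T) → f-best (suc (toℕ t))) (sum-p≡S T)

      S≤OPT : ∀ T → S T ≤ OPT (instance-with-best j) T
      S≤OPT T = subst (_≤ OPT (instance-with-best j) T) (cumulative-best T)
        (tabulate⁻ (xs≤max 0# (tabulate λ i → cumulative (instance-with-best j) i T)) j)

      -- The Concavity Envelope Exponent of the hard instance

      module Envelope (T : ℕ) (2≤T : 2 ℕ.≤ T) where

        private
          1<T : 1# < fromℕ T
          1<T = <-≤-trans (<-≤-trans (≤-by-difference 0≤1 refl , λ 1≡2 →
              0≢1 (sym (+-cancel 1≡2))) (≤-reflexive (cong (1# +_) (sym (+-identityʳ 1#)))))
            (fromℕ-mono-≤ 2≤T)
            where
            +-cancel : 1# ≡ 1# + 1# → 1# ≡ 0#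
            +-cancel eq = trans (solve 0 (:1 := :1 :+ :1 :- :1) refl)
              (trans (cong (_- 1#) (sym eq)) (-‿inverseʳ 1#))
          0<T : 0# < fromℕ T
          0<T = <-≤-trans 0<1 (proj₁ 1<T)
          ratio-nonneg : ∀ t → 0# ≤ fromℕ t / fromℕ T
          ratio-nonneg t = *-nonneg (fromℕ-nonneg t) (proj₁ (⁻¹-pos 0<T))

        -- The uncapped arm lies exactly on its envelope, with no room for a smaller exponent.
        p-rescale : ∀ t → p T * (fromℕ t / fromℕ T) ^ β ≡ p t
        p-rescale t = trans (sym (*-^ β 0<T (ratio-nonneg t))) (cong (_^ β) (x*[y/x]≡y (fromℕ t) 0<T))

        ratio^β≤1 : ∀ {t} → t ℕ.≤ T → (fromℕ t / fromℕ T) ^ β ≤ 1#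
        ratio^β≤1 {t} t≤T = ≤-trans
          (^-mono-≤ 0≤β (ratio-nonneg t)
            (≤*⇒/≤ 0<T (≤-trans (fromℕ-mono-≤ t≤T) (≤-reflexive (sym (*-identityʳ _))))))
          (≤-reflexive (1^a≡1 β))

        -- Up to the cap the envelope of `p` suffices, since `g T ≤ p T`. Beyond it `g t` is already
        -- the largest value of `g`, and the power of the ratio is at most 1.
        g-envelope : ∀ t → t ℕ.≤ T → g T * (fromℕ t / fromℕ T) ^ β ≤ g t
        g-envelope t t≤T with ℕ.≤-total t τ
        ... | inj₁ t≤τ = begin
          g T * (fromℕ t / fromℕ T) ^ β
            ≤⟨ *-monoˡ-≤ (^-nonneg β (ratio-nonneg t)) (p-mono-≤ (ℕ.m⊓n≤m T τ)) ⟩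
          p T * (fromℕ t / fromℕ T) ^ β
            ≡⟨ p-rescale t ⟩
          p t
            ≡⟨ g≡p t≤τ ⟨
          g t
            ∎
        ... | inj₂ τ≤t = begin
          g T * (fromℕ t / fromℕ T) ^ β
            ≤⟨ *-monoʳ-≤ (p-nonneg (T ℕ.⊓ τ)) (ratio^β≤1 t≤T) ⟩
          g T * 1#
            ≡⟨ *-identityʳ (g T) ⟩
          g T
            ≤⟨ g≤pτ T ⟩
          p τ
            ≡⟨ g≡pτ τ≤t ⟨
          g t
            ∎

        LE-β : ∀ i → LE (instance-with-best j) T β i
        LE-β i with i Fin.≟ j
        ... | yes _ = λ t _ → ≤-reflexive (p-rescale t)
        ... | no  _ = g-envelope

        -- The envelope condition at `t = 1` reads `T ^ β ≤ T ^ β′` after clearing the ratio, and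
        -- `log T` is positive because `T ≥ 2`.
        LE⇒β≤ : ∀ {β′} → LE (instance-with-best j) T β′ j → β ≤ β′
        LE⇒β≤ {β′} le = *-cancelˡ-≤ 0<L (subst₂ _≤_ (*-comm β L) (*-comm β′ L)
            (exp-cancel-≤ (subst₂ _≤_ (^≡exp β 0<T) (^≡exp β′ 0<T) T^β≤T^β′)))
          where
          L = log (fromℕ T)
          q = 1# / fromℕ T
          0<q : 0# < q
          0<q = *-pos 0<1 (⁻¹-pos 0<T)
          fromℕ1 : fromℕ 1 ≡ 1#
          fromℕ1 = +-identityʳ 1#
          0<L : 0# < L
          0<L = ≰⇒> λ L≤0 → <⇒≱ 1<T (subst₂ _≤_ (exp-log 0<T) exp-0 (exp-mono-≤ L≤0))
          T^β≤T^β′ : fromℕ T ^ β ≤ fromℕ T ^ β′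
          T^β≤T^β′ = *-cancelˡ-≤ (^-pos β′ 0<q) (begin
            q ^ β′ * fromℕ T ^ β                      ≡⟨ *-comm _ _ ⟩
            p T * q ^ β′                              ≡⟨ cong (λ o → p T * (o / fromℕ T) ^ β′) fromℕ1 ⟨
            p T * (fromℕ 1 / fromℕ T) ^ β′            ≡⟨ cong (_* (fromℕ 1 / fromℕ T) ^ β′) (f-best T) ⟨
            f j T * (fromℕ 1 / fromℕ T) ^ β′          ≤⟨ le 1 (ℕ.<⇒≤ 2≤T) ⟩
            f j 1                                     ≡⟨ f-best 1 ⟩
            p 1                                       ≡⟨ cong (_^ β) fromℕ1 ⟩
            1# ^ β                                    ≡⟨ trans (1^a≡1 β) (sym (1^a≡1 β′)) ⟩
            1# ^ β′                                   ≡⟨ cong (_^ β′) (trans (*-comm q _) (x*[y/x]≡y 1# 0<T)) ⟨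
            (q * fromℕ T) ^ β′                        ≡⟨ *-^-pos β′ 0<q 0<T ⟩
            q ^ β′ * fromℕ T ^ β′                     ∎)

        isConcavityEnvelopeExponent : IsConcavityEnvelopeExponent (instance-with-best j) T β
        isConcavityEnvelopeExponent =
          -- The infimum is attained: `β` itself is an admissible exponent.
          (λ { β′ (_ , _ , le) → LE⇒β≤ (le j) }) , λ b lower → lower β (0<β , β≤1 , LE-β)

    -- Counting pulls

    pulls-same : ∀ i {r} (h : History k) → pulls i ((i , r) ∷ h) ≡ suc (pulls i h)
    pulls-same i h = cong length (List.filter-accept (λ q → i Fin.≟ proj₁ q) refl)

    pulls-other : ∀ {i j} {r} (h : History k) → j ≢ i → pulls j ((i , r) ∷ h) ≡ pulls j h
    pulls-other {j = j} h j≢i = cong length (List.filter-reject (λ q → j Fin.≟ proj₁ q) j≢i)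

    pulls-mono : ∀ j (q : Fin k × ℝ) (h : History k) → pulls j h ℕ.≤ pulls j (q ∷ h)
    pulls-mono j (i , r) h with j Fin.≟ i
    ... | yes _ = ℕ.n≤1+n _
    ... | no  _ = ℕ.≤-refl

    sum-pulls : ∀ (h : History k) → sum (λ j → fromℕ (pulls j h)) ≡ fromℕ (length h)
    sum-pulls []            = sum-replicate-zero k
    sum-pulls ((i , r) ∷ h) = trans
      (sum-increment i (cong fromℕ (pulls-same i {r} h)) (λ j j≢i → cong fromℕ (pulls-other {r = r} h j≢i)))
      (cong (1# +_) (sum-pulls h))

    -- Comparison with the reference play

    module Play (A : Algorithm k) (T : ℕ) where

      open Algorithm A
      open module 𝔼 (h : History k) = Expectation (prob T h) (prob-nonneg T h) (prob-sum T h)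

      -- The expected number of pulls of arm j at the end of a play in which every
      -- arm, including j, pays according to g.
      finalPulls : ℕ → History k → Fin k → ℝ
      finalPulls zero    h j = fromℕ (pulls j h)
      finalPulls (suc n) h j = 𝔼 h λ i → finalPulls n ((i , g (suc (pulls i h))) ∷ h) j

      -- Each step pulls exactly one arm, so the total is the same on every branch; exchanging the
      -- sums over arms and over choices exposes this.
      sum-finalPulls : ∀ n h → sum (finalPulls n h) ≡ fromℕ (n ℕ.+ length h)
      sum-finalPulls zero    h = sum-pulls h
      sum-finalPulls (suc n) h = begin-equality
        sum (λ j → sum (λ i → prob T h i * next i j))    ≡⟨ ∑-comm (λ j i → prob T h i * next i j) ⟩
        sum (λ i → sum (λ j → prob T h i * next i j))    ≡⟨ sum-cong-≗ (λ i → *-distribˡ-sum (prob T h i) (next i)) ⟨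
        𝔼 h (λ i → sum (next i))                         ≡⟨ sum-cong-≗ (λ i → cong (prob T h i *_) (sum-finalPulls n _)) ⟩
        𝔼 h (λ _ → fromℕ (n ℕ.+ suc (length h)))         ≡⟨ 𝔼-const h _ ⟩
        fromℕ (n ℕ.+ suc (length h))                     ≡⟨ cong fromℕ (ℕ.+-suc n (length h)) ⟩
        fromℕ (suc n ℕ.+ length h)                       ∎
        where
        next : Fin k → Fin k → ℝ
        next i = finalPulls n ((i , g (suc (pulls i h))) ∷ h)

      -- Counts never decrease along a branch. This supplies the lower bound in Markov's inequality
      -- once `τ + 1` pulls have occurred.
      pulls≤finalPulls : ∀ n h j → fromℕ (pulls j h) ≤ finalPulls n h j
      pulls≤finalPulls zero    h j = ≤-refl
      pulls≤finalPulls (suc n) h j = ≤-trans (≤-reflexive (sym (𝔼-const h _)))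
        (𝔼-mono-≤ h λ i → ≤-trans (fromℕ-mono-≤ (pulls-mono j _ h)) (pulls≤finalPulls n _ j))

      module _ (j : Fin k) where

        open Instance (instance-with-best j) using (f)

        reward : ℕ → History k → ℝ
        reward = expectedReward (instance-with-best j) A T

        other≤pτ : ∀ {i} → i ≢ j → ∀ t → f i t ≤ p τ
        other≤pτ i≢j t = subst (_≤ p τ) (sym (f-other j i≢j t)) (g≤pτ t)

        -- The bound for the time after detection. Every remaining step is counted twice, once as a
        -- pull of a capped arm and once as a pull of arm `j`, so the way the algorithm mixes them
        -- does not matter.
        reward-crude : ∀ n h →
          reward n h ≤ fromℕ n * p τ + (S (pulls j h ℕ.+ n) - S (pulls j h))
        reward-crude zero    h = ≤-reflexive (sym (trans
          (cong (λ m → 0# * p τ + (S m - S (pulls j h))) (ℕ.+-identityʳ (pulls j h)))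
          (solve 2 (λ v s → :0 :* v :+ (s :- s) := :0) refl (p τ) (S (pulls j h)))))
        reward-crude (suc n) h =
          ≤-trans (𝔼-mono-≤ h (λ i → step i (i Fin.≟ j))) (≤-reflexive (𝔼-const h _))
          where
          m = pulls j h
          h′ : Fin k → History k
          h′ i = (i , f i (suc (pulls i h))) ∷ h
          step : ∀ i → Dec (i ≡ j) →
                 f i (suc (pulls i h)) + reward n (h′ i)
                   ≤ (1# + fromℕ n) * p τ + (S (m ℕ.+ suc n) - S m)
          step i (yes refl) = begin
            f i (suc m) + reward n (h′ i)
              ≤⟨ +-mono-≤ (≤-reflexive (f-best j (suc m))) (reward-crude n (h′ i)) ⟩
            p (suc m) + (fromℕ n * p τ + (S (pulls i (h′ i) ℕ.+ n) - S (pulls i (h′ i))))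
              ≡⟨ cong (λ l → p (suc m) + (fromℕ n * p τ + (S (l ℕ.+ n) - S l))) (pulls-same i h) ⟩
            p (suc m) + (fromℕ n * p τ + (S (suc m ℕ.+ n) - S (suc m)))
              ≡⟨ cong (λ l → p (suc m) + (fromℕ n * p τ + (S l - S (suc m)))) (ℕ.+-suc m n) ⟨
            p (suc m) + (fromℕ n * p τ + (S (m ℕ.+ suc n) - S (suc m)))
              ≤⟨ ≤-by-difference (p-nonneg τ)
                   (solve 5 (λ N v s q s′ → (:1 :+ N) :* v :+ (s′ :- s)
                       := q :+ (N :* v :+ (s′ :- (s :+ q))) :+ v)
                     refl (fromℕ n) (p τ) (S m) (p (suc m)) (S (m ℕ.+ suc n))) ⟩
            (1# + fromℕ n) * p τ + (S (m ℕ.+ suc n) - S m)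
              ∎
          step i (no i≢j) = begin
            f i (suc (pulls i h)) + reward n (h′ i)
              ≤⟨ +-mono-≤ (other≤pτ i≢j _) (reward-crude n (h′ i)) ⟩
            p τ + (fromℕ n * p τ + (S (pulls j (h′ i) ℕ.+ n) - S (pulls j (h′ i))))
              ≡⟨ cong (λ l → p τ + (fromℕ n * p τ + (S (l ℕ.+ n) - S l))) (pulls-other h (λ j≡i → i≢j (sym j≡i))) ⟩
            p τ + (fromℕ n * p τ + (S (m ℕ.+ n) - S m))
              ≤⟨ ≤-by-difference (x≤y⇒0≤y-x (S-mono-≤ (ℕ.+-monoʳ-≤ m (ℕ.n≤1+n n))))
                   (solve 5 (λ N v s s₁ s₂ → (:1 :+ N) :* v :+ (s₂ :- s)
                       := v :+ (N :* v :+ (s₁ :- s)) :+ (s₂ :- s₁))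
                     refl (fromℕ n) (p τ) (S m) (S (m ℕ.+ n)) (S (m ℕ.+ suc n))) ⟩
            (1# + fromℕ n) * p τ + (S (m ℕ.+ suc n) - S m)
              ∎

        -- Until arm j has been pulled more than τ times the play is
        -- indistinguishable from the one defining finalPulls; the later rewards
        -- from arm j total at most S T, charged to its τ + 1 pulls.
        reward-bound : ∀ n h → pulls j h ℕ.≤ τ → pulls j h ℕ.+ n ℕ.≤ T →
          reward n h ≤ fromℕ n * p τ + S T / fromℕ (suc τ) * finalPulls n h j
        reward-bound zero    h m≤τ m+n≤T = ≤-trans
          (*-nonneg (*-nonneg (S-nonneg T) (proj₁ (⁻¹-pos (fromℕ-pos τ)))) (fromℕ-nonneg (pulls j h)))
          (≤-reflexive (solve 2 (λ v e → e := :0 :* v :+ e) refl (p τ) _))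
        reward-bound (suc n) h m≤τ m+n≤T =
          ≤-trans (𝔼-mono-≤ h (λ i → step i (i Fin.≟ j))) (≤-reflexive (𝔼-affine h _ _ _))
          where
          m = pulls j h
          c = S T / fromℕ (suc τ)
          v = p τ
          0≤c : 0# ≤ c
          0≤c = *-nonneg (S-nonneg T) (proj₁ (⁻¹-pos (fromℕ-pos τ)))
          h′ h″ : Fin k → History k
          h′ i = (i , f i (suc (pulls i h))) ∷ h
          h″ i = (i , g (suc (pulls i h))) ∷ h
          undetected : ∀ i → f i (suc (pulls i h)) ≡ g (suc (pulls i h)) →
                       pulls j (h″ i) ℕ.≤ τ → pulls j (h″ i) ℕ.+ n ℕ.≤ T →
                       f i (suc (pulls i h)) + reward n (h′ i)
                         ≤ (1# + fromℕ n) * v + c * finalPulls n (h″ i) j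
          undetected i f≡g ≤τ ≤T = begin
            f i (suc (pulls i h)) + reward n (h′ i)
              -- Equal payments give equal histories, so the continuation is rewritten together with
              -- the reward.
              ≡⟨ cong (λ r → r + reward n ((i , r) ∷ h)) f≡g ⟩
            g (suc (pulls i h)) + reward n (h″ i)
              ≤⟨ +-mono-≤ (g≤pτ (suc (pulls i h))) (reward-bound n (h″ i) ≤τ ≤T) ⟩
            v + (fromℕ n * v + c * finalPulls n (h″ i) j)
              ≡⟨ solve 3 (λ N v e → v :+ (N :* v :+ e) := (:1 :+ N) :* v :+ e) refl (fromℕ n) v _ ⟩
            (1# + fromℕ n) * v + c * finalPulls n (h″ i) j
              ∎
          step : ∀ i → Dec (i ≡ j) →
                 f i (suc (pulls i h)) + reward n (h′ i)
                   ≤ (1# + fromℕ n) * v + c * finalPulls n (h″ i) j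
          step i (no i≢j) = undetected i (f-other j i≢j _)
            (subst (ℕ._≤ τ) (sym same) m≤τ)
            (subst (λ l → l ℕ.+ n ℕ.≤ T) (sym same)
              (ℕ.≤-trans (ℕ.+-monoʳ-≤ m (ℕ.n≤1+n n)) m+n≤T))
            where
            same : pulls j (h″ i) ≡ m
            same = pulls-other h (λ j≡i → i≢j (sym j≡i))
          step i (yes refl) with suc m ℕ.≤? τ
          ... | yes m<τ = undetected i (trans (f-best i (suc m)) (sym (g≡p m<τ)))
            (subst (ℕ._≤ τ) (sym more) m<τ)
            (subst (λ l → l ℕ.+ n ℕ.≤ T) (sym more) (subst (ℕ._≤ T) (ℕ.+-suc m n) m+n≤T))
            where
            more : pulls i (h″ i) ≡ suc m
            more = pulls-same i h
          -- Here `m = τ`: this is pull number `τ + 1` of arm `j`, the first whose payment may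
          -- differ from `g`. The crude bound takes over, and its partial sums are at most `S T`.
          ... | no m≮τ = begin
            f i (suc m) + reward n (h′ i)
              ≤⟨ +-mono-≤ (≤-reflexive (f-best j (suc m))) (reward-crude n (h′ i)) ⟩
            p (suc m) + (fromℕ n * v + (S (pulls i (h′ i) ℕ.+ n) - S (pulls i (h′ i))))
              ≡⟨ cong (λ l → p (suc m) + (fromℕ n * v + (S (l ℕ.+ n) - S l))) (pulls-same i h) ⟩
            p (suc m) + (fromℕ n * v + (S (suc m ℕ.+ n) - S (suc m)))
              ≤⟨ ≤-by-difference
                   (+-nonneg (p-nonneg τ) (+-nonneg (S-nonneg m)
                     (x≤y⇒0≤y-x (S-mono-≤ (subst (ℕ._≤ T) (ℕ.+-suc m n) m+n≤T)))))
                   (solve 6 (λ N v s q s₁ s₂ → (:1 :+ N) :* v :+ s₂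
                       := q :+ (N :* v :+ (s₁ :- (s :+ q))) :+ (v :+ (s :+ (s₂ :- s₁))))
                     refl (fromℕ n) v (S m) (p (suc m)) (S (suc m ℕ.+ n)) (S T)) ⟩
            (1# + fromℕ n) * v + S T
              ≡⟨ cong ((1# + fromℕ n) * v +_) (trans (*-comm c _) (x*[y/x]≡y (S T) (fromℕ-pos τ))) ⟨
            (1# + fromℕ n) * v + c * fromℕ (suc τ)
              -- The reference history `h″ i` already records `τ + 1` pulls, so its expected final
              -- count at price `c` covers `S T`.
              ≤⟨ +-monoʳ-≤ _ (*-monoʳ-≤ 0≤c (≤-trans (fromℕ-mono-≤ τ<m″) (pulls≤finalPulls n (h″ i) i))) ⟩
            (1# + fromℕ n) * v + c * finalPulls n (h″ i) i
              ∎
            where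
            τ<m″ : suc τ ℕ.≤ pulls i (h″ i)
            τ<m″ = subst (suc τ ℕ.≤_) (sym (pulls-same i h)) (ℕ.≰⇒> m≮τ)

  -- Optimising the cap

  module RegretBound (β : ℝ) (0<β : 0# < β) (β≤1 : β ≤ 1#) (k′ : ℕ) where

    open PowerReward β 0<β β≤1

    k : ℕ
    k = suc k′

    K b a δ γ y W x : ℝ
    K = fromℕ k
    b = β + 1#
    a = β * b
    δ = b ⁻¹
    γ = β / b
    y = a * K
    W = y ^ (- γ)
    -- The minimiser of (β + 1) x ^ β + 1 / (x k).
    x = exp (- (δ * log y))

    private
      0<K : 0# < K
      0<K = fromℕ-pos k′
      0<b : 0# < b
      0<b = +-pos 0<β 0≤1
      0<a : 0# < a
      0<a = *-pos 0<β 0<b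
      0<y : 0# < y
      0<y = *-pos 0<a 0<K
      0<x : 0# < x
      0<x = exp-pos _
      0<W : 0# < W
      0<W = ^-pos (- γ) 0<y

    x^β≡W : x ^ β ≡ W
    x^β≡W = begin-equality
      x ^ β                          ≡⟨ ^≡exp β 0<x ⟩
      exp (β * log x)                ≡⟨ cong (λ l → exp (β * l)) (log-exp _) ⟩
      exp (β * - (δ * log y))        ≡⟨ cong exp (solve 3 (λ β d l → β :* :- (d :* l) := :- (β :* d) :* l) refl β δ (log y)) ⟩
      exp (- γ * log y)              ≡⟨ ^≡exp (- γ) 0<y ⟨
      W                              ∎

    -- The first-order condition for the minimiser. It turns the detection cost `1 / (x k)` into
    -- `a W`, the same power of `k` as `x ^ β`.
    yWx≡1 : y * (W * x) ≡ 1#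
    yWx≡1 = begin-equality
      y * (W * x)                                ≡⟨ cong₂ (λ u w → u * (w * x)) (sym (exp-log 0<y)) (^≡exp (- γ) 0<y) ⟩
      exp Y * (exp (- γ * Y) * exp (- (δ * Y)))  ≡⟨ cong (exp Y *_) (exp-+ _ _) ⟨
      exp Y * exp (- γ * Y + - (δ * Y))          ≡⟨ cong (λ e → exp Y * exp e) exponent ⟩
      exp Y * exp (- Y)                          ≡⟨ exp-neg Y ⟩
      1#                                         ∎
      where
      Y = log y
      exponent : - γ * Y + - (δ * Y) ≡ - Y
      exponent = begin-equality
        - γ * Y + - (δ * Y)  ≡⟨ solve 3 (λ β d l → :- (β :* d) :* l :+ :- (d :* l) := :- (((β :+ :1) :* d) :* l)) refl β δ Y ⟩
        - (b * δ * Y)        ≡⟨ cong (λ o → - (o * Y)) (*-inverseʳ b (0<⇒≢0 0<b)) ⟩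
        - (1# * Y)           ≡⟨ cong -_ (*-identityˡ Y) ⟩
        - Y                  ∎

    -- The two terms are the rewards before and after arm j is recognised.
    two-phase-bound : ∀ T τ → fromℕ τ ≤ x * fromℕ T → x * fromℕ T ≤ fromℕ (suc τ) →
      fromℕ T * p τ + S T / fromℕ (suc τ) * (fromℕ T / K) ≤ b * b * W * S T
    two-phase-bound T τ τ≤xT xT≤1+τ = begin
      fromℕ T * p τ + S T / fromℕ (suc τ) * (fromℕ T / K)
        -- Rounding costs nothing: the first term uses `τ ≤ x T`, the second `x T ≤ τ + 1`. The two
        -- multiples of `W` then add up through `(β + 1) + β (β + 1) = (β + 1)²`.
        ≤⟨ +-mono-≤ before after ⟩
      W * (b * S T) + a * W * S T
        ≡⟨ solve 3 (λ β w s → w :* ((β :+ :1) :* s) :+ (β :* (β :+ :1)) :* w :* s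
             := (β :+ :1) :* (β :+ :1) :* w :* s) refl β W (S T) ⟩
      b * b * W * S T
        ∎
      where
      N = fromℕ T
      M = fromℕ (suc τ)
      0<M : 0# < M
      0<M = fromℕ-pos τ
      before : N * p τ ≤ W * (b * S T)
      before = begin
        N * p τ              ≤⟨ *-monoʳ-≤ (fromℕ-nonneg T) (^-mono-≤ (proj₁ 0<β) (fromℕ-nonneg τ) τ≤xT) ⟩
        N * (x * N) ^ β      ≡⟨ cong (N *_) (trans (*-^ β 0<x (fromℕ-nonneg T)) (cong (_* p T) x^β≡W)) ⟩
        N * (W * p T)        ≡⟨ solve 3 (λ n w q → n :* (w :* q) := w :* (n :* q)) refl N W (p T) ⟩
        W * (N * p T)        ≤⟨ *-monoʳ-≤ (proj₁ 0<W) (S-lower T) ⟩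
        W * (b * S T)        ∎
      after : S T / M * (N / K) ≤ a * W * S T
      after = *-cancelˡ-≤ (*-pos 0<M 0<K) (begin
        M * K * (S T / M * (N / K))
          ≡⟨ solve 6 (λ m k s n mi ki → m :* k :* (s :* mi :* (n :* ki)) := m :* (s :* mi) :* (k :* (n :* ki)))
               refl M K (S T) N (M ⁻¹) (K ⁻¹) ⟩
        M * (S T / M) * (K * (N / K))
          ≡⟨ cong₂ _*_ (x*[y/x]≡y (S T) 0<M) (x*[y/x]≡y N 0<K) ⟩
        S T * N
          ≡⟨ trans (cong (_* (S T * N)) yWx≡1) (*-identityˡ _) ⟨
        y * (W * x) * (S T * N)
          ≡⟨ solve 5 (λ y w x s n → y :* (w :* x) :* (s :* n) := y :* w :* s :* (x :* n)) refl y W x (S T) N ⟩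
        y * W * S T * (x * N)
          ≤⟨ *-monoʳ-≤ (*-nonneg (*-nonneg (proj₁ 0<y) (proj₁ 0<W)) (S-nonneg T)) xT≤1+τ ⟩
        y * W * S T * M
          ≡⟨ solve 5 (λ a k w s m → a :* k :* w :* s :* m := m :* k :* (a :* w :* s)) refl a K W (S T) M ⟩
        M * K * (a * W * S T)
          ∎)

    private
      0<3/2 : 0# < fromℕ 3 / fromℕ 2
      0<3/2 = *-pos (fromℕ-pos 2) (⁻¹-pos (fromℕ-pos 1))
      1≤3/2 : 1# ≤ fromℕ 3 / fromℕ 2
      1≤3/2 = *≤⇒≤/ (fromℕ-pos 1) (≤-trans (≤-reflexive (*-identityʳ _)) (fromℕ-mono-≤ (ℕ.n≤1+n 2)))

    C-pos : 0# < C β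
    C-pos = *-pos (*-pos 0<3/2 (*-pos 0<b 0<b)) (^-pos (- γ) 0<a)

    constant-bound : b * b * W ≤ C β * K ^ (- γ)
    constant-bound = begin
      b * b * W                                            ≡⟨ *-identityˡ _ ⟨
      1# * (b * b * W)                                     ≤⟨ *-monoˡ-≤ (*-nonneg (proj₁ (*-pos 0<b 0<b)) (proj₁ 0<W)) 1≤3/2 ⟩
      (fromℕ 3 / fromℕ 2) * (b * b * W)                    ≡⟨ cong (λ w → (fromℕ 3 / fromℕ 2) * (b * b * w)) (*-^-pos (- γ) 0<a 0<K) ⟩
      (fromℕ 3 / fromℕ 2) * (b * b * (a ^ (- γ) * K ^ (- γ)))
        ≡⟨ solve 4 (λ h b u v → h :* (b :* (u :* v)) := h :* b :* u :* v) 
             refl (fromℕ 3 / fromℕ 2) (b * b) (a ^ (- γ)) (K ^ (- γ)) ⟩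
      C β * K ^ (- γ)                                      ∎

    module _ (A : Algorithm k) (T : ℕ) (2≤T : 2 ℕ.≤ T) where

      private
        threshold : ∃[ n ] (fromℕ n ≤ x * fromℕ T × x * fromℕ T ≤ fromℕ (suc n))
        threshold = floor (*-nonneg (proj₁ 0<x) (fromℕ-nonneg T))

      τ : ℕ
      τ = proj₁ threshold

      open HardInstance β 0<β β≤1 τ {k}
      open Play A T

      -- The average is taken in the reference play, which depends on `τ` but on no choice of best
      -- arm, so building the instance from `j` is not circular.
      rarely-pulled : ∃[ j ] finalPulls T [] j ≤ fromℕ T / K
      rarely-pulled = sum≤⇒∃≤ (≤-reflexive (begin-equality
        sum (finalPulls T [])       ≡⟨ sum-finalPulls T [] ⟩
        fromℕ (T ℕ.+ 0)             ≡⟨ cong fromℕ (ℕ.+-identityʳ T) ⟩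
        fromℕ T                     ≡⟨ x*[y/x]≡y (fromℕ T) 0<K ⟨
        K * (fromℕ T / K)           ≡⟨ fromℕ*≡sum k ⟩
        sum {k} (λ _ → fromℕ T / K) ∎))

      j : Fin k
      j = proj₁ rarely-pulled

      hard : Instance k
      hard = instance-with-best j

      0<OPT : 0# < OPT hard T
      0<OPT = <-≤-trans (S-pos (ℕ.<⇒≤ 2≤T)) (S≤OPT j T)

      reward≤ : E[ALG] hard A T ≤ C β * K ^ (- γ) * OPT hard T
      reward≤ = begin
        E[ALG] hard A T
          ≤⟨ reward-bound j T [] z≤n ℕ.≤-refl ⟩
        fromℕ T * p τ + S T / fromℕ (suc τ) * finalPulls T [] j
          ≤⟨ +-monoʳ-≤ _ (*-monoʳ-≤ (*-nonneg (S-nonneg T) (proj₁ (⁻¹-pos (fromℕ-pos τ)))) (proj₂ rarely-pulled)) ⟩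
        fromℕ T * p τ + S T / fromℕ (suc τ) * (fromℕ T / K)
          ≤⟨ two-phase-bound T τ (proj₁ (proj₂ threshold)) (proj₂ (proj₂ threshold)) ⟩
        b * b * W * S T
          ≤⟨ *-mono-≤ (*-nonneg (proj₁ (*-pos 0<b 0<b)) (proj₁ 0<W)) constant-bound (S-nonneg T) (S≤OPT j T) ⟩
        C β * K ^ (- γ) * OPT hard T
          ∎

      reward-ratio : E[ALG] hard A T / OPT hard T ≤ C β * K ^ (- γ)
      reward-ratio = ≤*⇒/≤ 0<OPT (≤-trans reward≤ (≤-reflexive (*-comm _ _)))

      -- Positivity has to be assumed: when `τ` is 0 the capped arms pay nothing, and an algorithm
      -- that avoids arm `j` earns 0.
      competitive-ratio : 0# < E[ALG] hard A T → K ^ γ / C β ≤ OPT hard T / E[ALG] hard A T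
      competitive-ratio 0<E = *≤⇒≤/ 0<E (*-cancelˡ-≤ C-pos (begin
        C β * (E * (K ^ γ / C β))
          ≡⟨ solve 3 (λ c e w → c :* (e :* w) := e :* (c :* w)) refl (C β) E (K ^ γ / C β) ⟩
        E * (C β * (K ^ γ / C β))
          ≡⟨ cong (E *_) (x*[y/x]≡y (K ^ γ) C-pos) ⟩
        E * K ^ γ
          ≤⟨ *-monoˡ-≤ (proj₁ (^-pos γ 0<K)) reward≤ ⟩
        C β * K ^ (- γ) * OPT hard T * K ^ γ
          ≡⟨ solve 4 (λ c u o v → c :* u :* o :* v := c :* o :* (u :* v)) refl (C β) (K ^ (- γ)) (OPT hard T) (K ^ γ) ⟩
        C β * OPT hard T * (K ^ (- γ) * K ^ γ)
          ≡⟨ trans (cong (C β * OPT hard T *_) (^-neg-inverse γ 0<K)) (*-identityʳ _) ⟩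
        C β * OPT hard T
          ∎))
        where E = E[ALG] hard A T

theorem4p3p2 : (R : RealNumbers) →
    let open RealNumbers R
        open Bandits R
    in
    (β : ℝ) → 0# < β → β ≤ 1# →
    (k : ℕ) → 2 ℕ.≤ k →
    (A : Algorithm k) →
    ∃[ T₀ ] ∀ (T : ℕ) → T₀ ℕ.≤ T →
    ∃[ I ]
      IsConcavityEnvelopeExponent {k} I T β
      × 0# < OPT I T
      × E[ALG] I A T / OPT I T ≤ C β * fromℕ k ^ (- (β / (β + 1#)))
      × (0# < E[ALG] I A T →
         fromℕ k ^ (β / (β + 1#)) / C β ≤ OPT I T / E[ALG] I A T)
-- At `T = 1` every exponent in (0, 1] meets the envelope condition and the infimum would be 0, so
-- the threshold is 2.
theorem4p3p2 R β 0<β β≤1 (suc k′) _ A = 2 , λ T 2≤T →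
  let open LowerBound R
      open RegretBound β 0<β β≤1 k′
      open HardInstance β 0<β β≤1 (τ A T 2≤T)
      open Envelope (j A T 2≤T) T 2≤T
  in hard A T 2≤T , isConcavityEnvelopeExponent , 0<OPT A T 2≤T ,
     reward-ratio A T 2≤T , competitive-ratio A T 2≤T
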